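{- For odd $n\ge 3$, the graph $\mathcal{H}_n$ is connected.
   Context: Fix an integer $n\ge 2$ and place $2n$ points equidistantly on the unit circle. $\mathcal{M}_n$ is the set of all non-crossing straight-line perfect matchings on these $2n$ points (each has $n$ edges). For $M\in\mathcal{M}_n$, two edges $e,f\in M$ span an empty quadrilateral if the convex hull of $e$ and $f$ contains no other edge of $M$; replacing $e,f$ by the other two edges of this quadrilateral yields another matching of $\mathcal{M}_n$ (a flip). A flip is centered if the closed quadrilateral contains the center of the circle (possibly on its boundary). $\mathcal{H}_n$ is the graph with vertex set $\mathcal{M}_n$ and an edge between two matchings if they differ by a centered flip. -}

module Defs where

open import Data.Nat using (ℕ; _+_; _*_; _∸_; _≤_; _<_)
open import Data.Fin using (Fin; toℕ)
open import Data.Product using (Σ; _×_; ∃; proj₁)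
open import Data.Sum using (_⊎_)
open import Relation.Nullary using (¬_)
open import Relation.Binary.PropositionalEquality using (_≡_; _≢_)
open import Relation.Binary.Construct.Closure.ReflexiveTransitive using (Star)

module _ (n : ℕ) where

  -- The 2n points on the unit circle are labelled 0,1,…,2n-1 in
  -- counterclockwise order; point k sits at angle k·π/n.
  Point : Set
  Point = Fin (2 * n)

  _≺_ : Point → Point → Set
  i ≺ j = toℕ i < toℕ j

  -- A perfect matching is given by its partner map: a fixed-point-free involution.
  IsPerfectMatching : (Point → Point) → Set
  IsPerfectMatching m = (∀ i → m (m i) ≡ i) × (∀ i → m i ≢ i)

  -- Two chords {i, m i} and {j, m j} (written with i ≺ m i, j ≺ m j) cross
  -- (as straight segments between points in convex position) iff their
  -- endpoints interleave: i ≺ j ≺ m i ≺ m j.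
  IsNonCrossing : (Point → Point) → Set
  IsNonCrossing m =
    ∀ i j → i ≺ m i → j ≺ m j → ¬ (i ≺ j × j ≺ m i × m i ≺ m j)

  IsNCPM : (Point → Point) → Set
  IsNCPM m = IsPerfectMatching m × IsNonCrossing m

  NCPM : Set
  NCPM = Σ (Point → Point) IsNCPM

  SameArc : (p₁ p₂ p₃ p₄ x y : Point) → Set
  SameArc p₁ p₂ p₃ p₄ x y =
      (p₁ ≺ x × x ≺ p₂ × p₁ ≺ y × y ≺ p₂)
    ⊎ (p₂ ≺ x × x ≺ p₃ × p₂ ≺ y × y ≺ p₃)
    ⊎ (p₃ ≺ x × x ≺ p₄ × p₃ ≺ y × y ≺ p₄)
    ⊎ ((x ≺ p₁ ⊎ p₄ ≺ x) × (y ≺ p₁ ⊎ p₄ ≺ y))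

  Avoids : (p₁ p₂ p₃ p₄ x : Point) → Set
  Avoids p₁ p₂ p₃ p₄ x = x ≢ p₁ × x ≢ p₂ × x ≢ p₃ × x ≢ p₄

  -- The quadrilateral with vertices p₁ ≺ p₂ ≺ p₃ ≺ p₄ (convex hull of the two
  -- matching edges on these points) is empty w.r.t. the matching m: no other
  -- edge {x, m x} of m meets it.  A chord whose endpoints are not vertices of
  -- the inscribed quadrilateral meets the closed quadrilateral iff its two
  -- endpoints lie in different open arcs.
  EmptyQuad : (Point → Point) → (p₁ p₂ p₃ p₄ : Point) → Set
  EmptyQuad m p₁ p₂ p₃ p₄ =
    ∀ x → Avoids p₁ p₂ p₃ p₄ x → SameArc p₁ p₂ p₃ p₄ x (m x)

  -- The closed inscribed quadrilateral p₁ ≺ p₂ ≺ p₃ ≺ p₄ contains the centre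
  -- iff every arc between cyclically consecutive vertices is at most a
  -- semicircle, i.e. spans at most n of the 2n unit steps (equality: that
  -- side is a diameter and the centre lies on the boundary).
  Centered : (p₁ p₂ p₃ p₄ : Point) → Set
  Centered p₁ p₂ p₃ p₄ =
      toℕ p₂ ∸ toℕ p₁ ≤ n
    × toℕ p₃ ∸ toℕ p₂ ≤ n
    × toℕ p₄ ∸ toℕ p₃ ≤ n
    × (2 * n + toℕ p₁) ∸ toℕ p₄ ≤ n

  HasEdges : (Point → Point) → (a b c d : Point) → Set
  HasEdges m a b c d = m a ≡ b × m b ≡ a × m c ≡ d × m d ≡ c

  -- A flip: on the four points p₁ ≺ p₂ ≺ p₃ ≺ p₄ the matching m uses one of the
  -- two non-crossing pairings and m' the other one (these are the two pairs of
  -- opposite sides of the quadrilateral), the two edges of m span an empty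
  -- quadrilateral, and m, m' agree everywhere else.
  FlipAt : (m m' : Point → Point) → (p₁ p₂ p₃ p₄ : Point) → Set
  FlipAt m m' p₁ p₂ p₃ p₄ =
      p₁ ≺ p₂ × p₂ ≺ p₃ × p₃ ≺ p₄
    × ((HasEdges m p₁ p₂ p₃ p₄ × HasEdges m' p₁ p₄ p₂ p₃)
       ⊎ (HasEdges m p₁ p₄ p₂ p₃ × HasEdges m' p₁ p₂ p₃ p₄))
    × EmptyQuad m p₁ p₂ p₃ p₄
    × (∀ x → Avoids p₁ p₂ p₃ p₄ x → m' x ≡ m x)

  CenteredFlip : NCPM → NCPM → Set
  CenteredFlip M M' =
    ∃ λ p₁ → ∃ λ p₂ → ∃ λ p₃ → ∃ λ p₄ →
      FlipAt (proj₁ M) (proj₁ M') p₁ p₂ p₃ p₄ × Centered p₁ p₂ p₃ p₄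

  -- 𝓗ₙ is connected: any two vertices are joined by a path of centered flips.
  -- (The flip relation is symmetric, so reflexive–transitive closure suffices.)
  Connected𝓗 : Set
  Connected𝓗 = (M M' : NCPM) → Star CenteredFlip M M'

Odd : ℕ → Set
Odd n = Σ ℕ (λ k → n ≡ 1 + 2 * k)

{-# OPTIONS --safe #-}
module Submission where

-- A non-crossing matching of points 0, …, 2n-1 is a balanced bracket word, i.e. a
-- plane forest.  Up to rotation a centered flip exchanges (u)v(z)t and (u(v)z)t,
-- and it is centered iff u, v, z, t each have at most H edges, where n = 2H + 1.
-- Induction from n - 2 to n: inserting boundary edges {0, 1} and {n, n+1} keeps
-- centered flips centered, so all matchings having both edges are connected.
-- Every matching reaches such an antipodal pair up to rotation: growing one chord
-- by flips produces a diameter, as in ((v)z)(x)y, and if |v| ≤ |x| (otherwise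
-- exchange the two halves) two flips lead through ()v(z)(x)y to ()v(z()x)y.
-- Finally, with |A| = H - 1, (()A)()A has a diameter and so reaches an antipodal
-- pair at 0, but its rotation by one point already has one there, so the position
-- of the antipodal pair is immaterial.

open import Defs
open import Data.Empty using (⊥; ⊥-elim)
open import Data.Fin using (toℕ; fromℕ<)
open import Data.Fin.Properties using (toℕ-fromℕ<; toℕ-injective; toℕ<n)
open import Data.Nat using (ℕ; zero; suc; pred; >-nonZero; _+_; _*_; _∸_; _≤_; _<_; z≤n; s≤s; s≤s⁻¹; z<s; _<?_; _≤?_; _≟_)
open import Data.Nat.Properties
open import Data.Nat.Tactic.RingSolver using (solve-∀)
open import Data.Product using (Σ; ∃; _×_; _,_; proj₁; proj₂)
open import Data.Sum using (_⊎_; inj₁; inj₂)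
open import Relation.Binary using (tri<; tri≈; tri>)
open import Relation.Binary.Construct.Closure.ReflexiveTransitive using (Star; _◅_; _◅◅_; gmap; reverse) renaming (ε to done)
open import Relation.Binary.PropositionalEquality
open import Relation.Nullary using (¬_; yes; no)

-- Bracket words and their matched positions

-- ⟨ u ⟩ w is the bracket word (u)w.
data Forest : Set where
  ε    : Forest
  ⟨_⟩_ : Forest → Forest → Forest

infixr 6 ⟨_⟩_
infixr 5 _++_

_++_ : Forest → Forest → Forest
ε         ++ t = t
(⟨ u ⟩ w) ++ t = ⟨ u ⟩ (w ++ t)

size : Forest → ℕ
size ε         = 0
size (⟨ u ⟩ w) = suc (size u + size w)

end : ℕ → Forest → ℕ
end a ε         = a
end a (⟨ u ⟩ w) = end (suc (end (suc a) u)) w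

-- Positions i and j are matched in the bracket word of the forest, written from
-- position a on; end a F is the first position behind it.
data E (a : ℕ) : Forest → ℕ → ℕ → Set where
  opens  : ∀ {u w i j} → i ≡ a → j ≡ end (suc a) u → E a (⟨ u ⟩ w) i j
  closes : ∀ {u w i j} → i ≡ end (suc a) u → j ≡ a → E a (⟨ u ⟩ w) i j
  inside : ∀ {u w i j} → E (suc a) u i j → E a (⟨ u ⟩ w) i j
  after  : ∀ {u w i j} → E (suc (end (suc a) u)) w i j → E a (⟨ u ⟩ w) i j

++-assoc : ∀ u v w → (u ++ v) ++ w ≡ u ++ (v ++ w)
++-assoc ε         v w = refl
++-assoc (⟨ t ⟩ u) v w = cong (⟨ t ⟩_) (++-assoc u v w)

++-identityʳ : ∀ u → u ++ ε ≡ u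
++-identityʳ ε         = refl
++-identityʳ (⟨ t ⟩ u) = cong (⟨ t ⟩_) (++-identityʳ u)

size-++ : ∀ u w → size (u ++ w) ≡ size u + size w
size-++ ε         w = refl
size-++ (⟨ t ⟩ u) w = cong suc (trans (cong (size t +_) (size-++ u w)) (sym (+-assoc (size t) (size u) (size w))))

end-++ : ∀ a u w → end a (u ++ w) ≡ end (end a u) w
end-++ a ε         w = refl
end-++ a (⟨ t ⟩ u) w = end-++ _ u w

end-suc : ∀ a F → end (suc a) F ≡ suc (end a F)
end-suc a ε         = refl
end-suc a (⟨ u ⟩ w) =
  trans (cong (λ b → end (suc b) w) (end-suc (suc a) u)) (end-suc (suc (end (suc a) u)) w)

end-size : ∀ a F → end a F ≡ 2 * size F + a
end-size a ε         = refl
end-size a (⟨ u ⟩ w) = begin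
  end (suc (end (suc a) u)) w                      ≡⟨ end-size _ w ⟩
  2 * size w + suc (end (suc a) u)                 ≡⟨ cong (λ b → 2 * size w + suc b) (end-size (suc a) u) ⟩
  2 * size w + suc (2 * size u + suc a)            ≡⟨ arith (size u) (size w) a ⟩
  2 * suc (size u + size w) + a                    ∎
  where
  open ≡-Reasoning
  arith : ∀ x y a → 2 * y + (1 + (2 * x + (1 + a))) ≡ 2 * (1 + (x + y)) + a
  arith = solve-∀

start≤end : ∀ a F → a ≤ end a F
start≤end a F = subst (a ≤_) (sym (end-size a F)) (m≤n+m a _)

E-sym : ∀ {a F i j} → E a F i j → E a F j i
E-sym (opens p q)  = closes q p
E-sym (closes p q) = opens q p
E-sym (inside e)   = inside (E-sym e)
E-sym (after e)    = after (E-sym e)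

E-cast : ∀ {a b F i j} → a ≡ b → E a F i j → E b F i j
E-cast refl e = e

E-lower : ∀ {a F i j} → E a F i j → a ≤ i
E-lower (opens refl _)              = ≤-refl
E-lower {a} (closes {u = u} refl _) = ≤-trans (n≤1+n a) (start≤end (suc a) u)
E-lower (inside e)                  = <⇒≤ (E-lower e)
E-lower {a} (after {u = u} e)       =
  ≤-trans (≤-trans (n≤1+n a) (start≤end (suc a) u)) (<⇒≤ (E-lower e))

E-upper : ∀ {a F i j} → E a F i j → i < end a F
E-upper {a} (opens {u} {w} refl _)  = ≤-trans (s≤s (<⇒≤ (start≤end (suc a) u))) (start≤end _ w)
E-upper {a} (closes {u} {w} refl _) = start≤end _ w
E-upper {a} (inside {u} {w} e)      = ≤-trans (<⇒≤ (s≤s (E-upper e))) (start≤end _ w)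
E-upper (after e)                   = E-upper e

E-irrefl : ∀ {a F i} → ¬ E a F i i
E-irrefl {a} (opens {u} refl q)  = <⇒≢ (start≤end (suc a) u) q
E-irrefl {a} (closes {u} q refl) = <⇒≢ (start≤end (suc a) u) q
E-irrefl (inside e)              = E-irrefl e
E-irrefl (after e)               = E-irrefl e

-- The four constructors put i at the opening bracket, at the closing bracket, strictly between
-- them, or behind both. These ranges are disjoint, so all mixed cases contradict the bounds.
E-functional : ∀ {a F i j k} → E a F i j → E a F i k → j ≡ k
E-functional (opens _ refl) (opens _ q) = sym q
E-functional {a} (opens {u} refl _) (closes q _) = ⊥-elim (<⇒≢ (start≤end (suc a) u) q)
E-functional (opens refl _) (inside e) = ⊥-elim (<-irrefl refl (E-lower e))
E-functional {a} (opens {u} refl _) (after e) =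
  ⊥-elim (<-asym (E-lower e) (start≤end (suc a) u))
E-functional {a} (closes {u} q _) (opens refl _) = ⊥-elim (<⇒≢ (start≤end (suc a) u) q)
E-functional (closes _ refl) (closes _ q) = sym q
E-functional (closes refl _) (inside e) = ⊥-elim (<-irrefl refl (E-upper e))
E-functional (closes refl _) (after e) = ⊥-elim (<-irrefl refl (E-lower e))
E-functional (inside e) (opens refl _) = ⊥-elim (<-irrefl refl (E-lower e))
E-functional (inside e) (closes refl _) = ⊥-elim (<-irrefl refl (E-upper e))
E-functional (inside e) (inside f) = E-functional e f
E-functional (inside e) (after f) = ⊥-elim (<-asym (E-lower f) (E-upper e))
E-functional {a} (after {u} e) (opens refl _) =
  ⊥-elim (<-asym (E-lower e) (start≤end (suc a) u))
E-functional (after e) (closes refl _) = ⊥-elim (<-irrefl refl (E-lower e))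
E-functional (after e) (inside f) = ⊥-elim (<-asym (E-lower e) (E-upper f))
E-functional (after e) (after f) = E-functional e f

E-total : ∀ {a} F {i} → a ≤ i → i < end a F → ∃ (E a F i)
E-total ε a≤i i<a = ⊥-elim (<-irrefl refl (<-≤-trans i<a a≤i))
E-total {a} (⟨ u ⟩ w) {i} a≤i i<b with a ≟ i
... | yes a≡i = _ , opens (sym a≡i) refl
... | no a≢i with <-cmp i (end (suc a) u)
...   | tri< i<c _ _ = let j , e = E-total u (≤∧≢⇒< a≤i a≢i) i<c in j , inside e
...   | tri≈ _ i≡c _ = _ , closes i≡c refl
...   | tri> _ _ c<i = let j , e = E-total w c<i i<b in j , after e

-- Chords from different parts of the word are nested or disjoint by `E-lower` and `E-upper`; chords
-- from the same part are handled by recursion.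
E-noncrossing : ∀ {a F i j k l} → E a F i j → E a F k l → i < k → k < j → j < l → ⊥
E-noncrossing (opens refl _) (opens refl _) i<k _ _ = <-irrefl refl i<k
E-noncrossing (opens _ refl) (closes refl _) _ k<j _ = <-irrefl refl k<j
E-noncrossing (opens _ refl) (inside f) _ _ j<l = <-asym j<l (E-upper (E-sym f))
E-noncrossing (opens _ refl) (after f) _ k<j _ = <-asym k<j (E-lower f)
E-noncrossing {a} (closes {u} refl refl) _ i<k k<j _ =
  <-asym (<-trans i<k k<j) (start≤end (suc a) u)
E-noncrossing (inside e) (opens refl _) i<k _ _ = <-asym i<k (E-lower e)
E-noncrossing (inside e) (closes refl _) _ k<j _ = <-asym k<j (E-upper (E-sym e))
E-noncrossing (inside e) (inside f) = E-noncrossing e f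
E-noncrossing (inside e) (after f) _ k<j _ =
  <-asym k<j (<-trans (E-upper (E-sym e)) (E-lower f))
E-noncrossing {a} (after {u} e) (opens refl _) i<k _ _ =
  <-asym i<k (<-trans (start≤end (suc a) u) (E-lower e))
E-noncrossing (after e) (closes refl _) i<k _ _ = <-asym i<k (E-lower e)
E-noncrossing (after e) (inside f) i<k _ _ =
  <-asym i<k (<-trans (E-upper f) (E-lower e))
E-noncrossing (after e) (after f) = E-noncrossing e f

E-++ˡ : ∀ {a u w i j} → E a u i j → E a (u ++ w) i j
E-++ˡ (opens p q)  = opens p q
E-++ˡ (closes p q) = closes p q
E-++ˡ (inside e)   = inside e
E-++ˡ (after e)    = after (E-++ˡ e)

E-++ʳ : ∀ {a} u {w i j} → E (end a u) w i j → E a (u ++ w) i j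
E-++ʳ ε         e = e
E-++ʳ (⟨ t ⟩ u) e = after (E-++ʳ u e)

E-++⁻ : ∀ {a} u {w i j} → E a (u ++ w) i j → E a u i j ⊎ E (end a u) w i j
E-++⁻ ε e = inj₂ e
E-++⁻ (⟨ t ⟩ u) (opens p q)  = inj₁ (opens p q)
E-++⁻ (⟨ t ⟩ u) (closes p q) = inj₁ (closes p q)
E-++⁻ (⟨ t ⟩ u) (inside e)   = inj₁ (inside e)
E-++⁻ (⟨ t ⟩ u) (after e) with E-++⁻ u e
... | inj₁ f = inj₁ (after f)
... | inj₂ f = inj₂ f

E-suc : ∀ {a F i j} → E a F i j → E (suc a) F (suc i) (suc j)
E-suc {a} (opens {u} refl refl)  = opens refl (sym (end-suc (suc a) u))
E-suc {a} (closes {u} refl refl) = closes (sym (end-suc (suc a) u)) refl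
E-suc (inside e)                 = inside (E-suc e)
E-suc {a} (after {u} e)          = after (E-cast (cong suc (sym (end-suc (suc a) u))) (E-suc e))

E-suc⁻ : ∀ {a F i j} → E (suc a) F i j →
         ∃ λ i′ → ∃ λ j′ → i ≡ suc i′ × j ≡ suc j′ × E a F i′ j′
E-suc⁻ {a} (opens {u} refl refl)  = _ , _ , refl , end-suc (suc a) u , opens refl refl
E-suc⁻ {a} (closes {u} refl refl) = _ , _ , end-suc (suc a) u , refl , closes refl refl
E-suc⁻ (inside e) with E-suc⁻ e
... | _ , _ , p , q , f = _ , _ , p , q , inside f
E-suc⁻ {a} (after {u} e) with E-suc⁻ (E-cast (cong suc (end-suc (suc a) u)) e)
... | _ , _ , p , q , f = _ , _ , p , q , after f

-- Centered flips of bracket words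

Arc : (p₁ p₂ p₃ p₄ x y : ℕ) → Set
Arc p₁ p₂ p₃ p₄ x y =
    (p₁ < x × x < p₂ × p₁ < y × y < p₂)
  ⊎ (p₂ < x × x < p₃ × p₂ < y × y < p₃)
  ⊎ (p₃ < x × x < p₄ × p₃ < y × y < p₄)
  ⊎ ((x < p₁ ⊎ p₄ < x) × (y < p₁ ⊎ p₄ < y))

Off : (p₁ p₂ p₃ p₄ x : ℕ) → Set
Off p₁ p₂ p₃ p₄ x = x ≢ p₁ × x ≢ p₂ × x ≢ p₃ × x ≢ p₄

Pairs : Forest → (a b c d : ℕ) → Set
Pairs F a b c d = E 0 F a b × E 0 F c d

-- Positions are plain numbers, so that rotating and inserting become arithmetic. The fields `arc₁`
-- to `arc₄` express `Centered` without truncated subtraction; `arc₄` is the arc that wraps around.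
record Flip (n : ℕ) (F G : Forest) : Set where
  constructor mkFlip
  field
    sizeˡ : size F ≡ n
    sizeʳ : size G ≡ n
    {p₁ p₂ p₃ p₄} : ℕ
    p₁<p₂ : p₁ < p₂
    p₂<p₃ : p₂ < p₃
    p₃<p₄ : p₃ < p₄
    pairs : (Pairs F p₁ p₂ p₃ p₄ × Pairs G p₁ p₄ p₂ p₃)
          ⊎ (Pairs F p₁ p₄ p₂ p₃ × Pairs G p₁ p₂ p₃ p₄)
    empty : ∀ {x y} → E 0 F x y → Off p₁ p₂ p₃ p₄ x → Arc p₁ p₂ p₃ p₄ x y
    agree : ∀ {x y} → E 0 F x y → Off p₁ p₂ p₃ p₄ x → E 0 G x y
    arc₁  : p₂ ≤ n + p₁
    arc₂  : p₃ ≤ n + p₂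
    arc₃  : p₄ ≤ n + p₃
    arc₄  : n + p₁ ≤ p₄

E-bound : ∀ {n F i j} → size F ≡ n → E 0 F i j → i < 2 * n
E-bound {F = F} refl e = subst (_ <_) (trans (end-size 0 F) (+-identityʳ _)) (E-upper e)

E-at : ∀ {n} F {i} → size F ≡ n → i < 2 * n → ∃ (E 0 F i)
E-at F refl i<2n = E-total F z≤n (subst (_ <_) (sym (trans (end-size 0 F) (+-identityʳ _))) i<2n)

last-matched : ∀ {F p₁ p₂ p₃ p₄} {A B : Set} →
               (Pairs F p₁ p₂ p₃ p₄ × A) ⊎ (Pairs F p₁ p₄ p₂ p₃ × B) → ∃ (E 0 F p₄)
last-matched (inj₁ ((_ , e) , _)) = _ , E-sym e
last-matched (inj₂ ((e , _) , _)) = _ , E-sym e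

-- The field `agree` reverses because matchings are total and functional: the edge of F at x is
-- carried to G and must be the given one.
Flip-sym : ∀ {n F G} → Flip n F G → Flip n G F
Flip-sym {n} {F} {G} (mkFlip sF sG {p₁} {p₂} {p₃} {p₄} <₁ <₂ <₃ pairs empty agree a₁ a₂ a₃ a₄) =
  mkFlip sG sF <₁ <₂ <₃ (swap pairs) (λ e o → empty (agree⁻ e o) o) agree⁻ a₁ a₂ a₃ a₄
  where
  swap : ∀ {A B C D : Set} → (A × B) ⊎ (C × D) → (D × C) ⊎ (B × A)
  swap (inj₁ (a , b)) = inj₂ (b , a)
  swap (inj₂ (c , d)) = inj₁ (d , c)
  agree⁻ : ∀ {x y} → E 0 G x y → Off p₁ p₂ p₃ p₄ x → E 0 F x y
  agree⁻ e o =
    let y′ , e′ = E-at F sF (E-bound sG e)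
    in subst (E 0 F _) (E-functional (agree e′ o) e) e′

-- An arc enclosing m edges has 2m interior points, hence 2m + 1 unit steps; with n = 2H + 1 it is
-- at most a semicircle when m ≤ H.
2m+1≤ : ∀ {m H} → m ≤ H → 2 * m + 1 ≤ suc (2 * H)
2m+1≤ {m} {H} m≤H = subst (_≤ suc (2 * H)) (+-comm 1 (2 * m)) (s≤s (*-monoʳ-≤ 2 m≤H))

-- Merging the first tree with a later one

-- The corners 0, `p₂`, `p₃`, `p₄` cut the circle into arcs holding exactly u, v, z and t. Each size
-- bound thus gives one arc bound, and every other edge lies within one of the four words.
merge : ∀ {H} u v z t → size u ≤ H → size v ≤ H → size z ≤ H → size t ≤ H →
        size (⟨ u ⟩ (v ++ ⟨ z ⟩ t)) ≡ suc (2 * H) →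
        Flip (suc (2 * H)) (⟨ u ⟩ (v ++ ⟨ z ⟩ t)) (⟨ u ++ ⟨ v ⟩ z ⟩ t)
merge {H} u v z t u≤ v≤ z≤ t≤ sz =
  mkFlip sz sz′ (start≤end 1 u) p₂<p₃ (start≤end (suc p₃) z)
    (inj₁ ((opens refl refl , after (E-++ʳ v (opens refl refl)))
         , (opens refl (sym p₄≡) , inside (E-++ʳ u (opens refl refl)))))
    empty agree
    (arc 0 u u≤) (arc p₂ v v≤) (arc p₃ z z≤)
    bound₄
  where
  n  = suc (2 * H)
  p₂ = end 1 u
  p₃ = end (suc p₂) v
  p₄ = end (suc p₃) z
  p₂<p₃ : p₂ < p₃
  p₂<p₃ = start≤end (suc p₂) v
  p₄≡ : end 1 (u ++ ⟨ v ⟩ z) ≡ p₄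
  p₄≡ = end-++ 1 u (⟨ v ⟩ z)
  sz′ : size (⟨ u ++ ⟨ v ⟩ z ⟩ t) ≡ n
  sz′ = trans (cong (λ s → suc (s + size t)) (size-++ u (⟨ v ⟩ z)))
       (trans (lem (size u) (size v) (size z) (size t))
       (trans (cong (λ s → suc (size u + s)) (sym (size-++ v (⟨ z ⟩ t)))) sz))
    where
    lem : ∀ a b c d → 1 + ((a + (1 + (b + c))) + d) ≡ 1 + (a + (b + (1 + (c + d))))
    lem = solve-∀
  arc : ∀ a s → size s ≤ H → end (suc a) s ≤ n + a
  arc a s s≤ = subst (_≤ n + a) (sym (trans (end-size (suc a) s) (lem (2 * size s) a)))
                 (+-monoˡ-≤ a (2m+1≤ s≤))
    where
    lem : ∀ x a → x + (1 + a) ≡ (x + 1) + a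
    lem = solve-∀
  total : 2 * size t + suc p₄ ≡ 2 * n
  total = trans (sym (end-size (suc p₄) t))
         (trans (sym (end-++ (suc p₂) v (⟨ z ⟩ t)))
         (trans (end-size 0 (⟨ u ⟩ (v ++ ⟨ z ⟩ t)))
         (trans (+-identityʳ _) (cong (2 *_) sz))))
  -- The arc around t leads from `p₄` past the last point to 0, so its length 2|t| + 1 is compared
  -- with the total 2n.
  bound₄ : n + 0 ≤ p₄
  bound₄ = +-cancelˡ-≤ (2 * size t + 1) _ _
    (≤-trans (+-monoˡ-≤ (n + 0) (2m+1≤ t≤))
      (≤-reflexive (trans (lem n) (trans (sym total) (lem′ (2 * size t) p₄)))))
    where
    lem : ∀ n → n + (n + 0) ≡ 2 * n
    lem = solve-∀
    lem′ : ∀ x p → x + (1 + p) ≡ (x + 1) + p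
    lem′ = solve-∀
  empty : ∀ {x y} → E 0 (⟨ u ⟩ (v ++ ⟨ z ⟩ t)) x y → Off 0 p₂ p₃ p₄ x → Arc 0 p₂ p₃ p₄ x y
  empty (opens p _) (o₁ , _) = ⊥-elim (o₁ p)
  empty (closes p _) (_ , o₂ , _) = ⊥-elim (o₂ p)
  empty (inside e) _ = inj₁ (E-lower e , E-upper e , E-lower (E-sym e) , E-upper (E-sym e))
  empty (after e) (_ , _ , o₃ , o₄) with E-++⁻ v e
  ... | inj₁ f = inj₂ (inj₁ (E-lower f , E-upper f , E-lower (E-sym f) , E-upper (E-sym f)))
  ... | inj₂ (opens p _) = ⊥-elim (o₃ p)
  ... | inj₂ (closes p _) = ⊥-elim (o₄ p)
  ... | inj₂ (inside f) =
        inj₂ (inj₂ (inj₁ (E-lower f , E-upper f , E-lower (E-sym f) , E-upper (E-sym f))))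
  ... | inj₂ (after f) = inj₂ (inj₂ (inj₂ (inj₂ (E-lower f) , inj₂ (E-lower (E-sym f)))))
  agree : ∀ {x y} → E 0 (⟨ u ⟩ (v ++ ⟨ z ⟩ t)) x y → Off 0 p₂ p₃ p₄ x →
          E 0 (⟨ u ++ ⟨ v ⟩ z ⟩ t) x y
  agree (opens p _) (o₁ , _) = ⊥-elim (o₁ p)
  agree (closes p _) (_ , o₂ , _) = ⊥-elim (o₂ p)
  agree (inside e) _ = inside (E-++ˡ e)
  agree (after e) (_ , _ , o₃ , o₄) with E-++⁻ v e
  ... | inj₁ f = inside (E-++ʳ u (inside f))
  ... | inj₂ (opens p _) = ⊥-elim (o₃ p)
  ... | inj₂ (closes p _) = ⊥-elim (o₄ p)
  ... | inj₂ (inside f) = inside (E-++ʳ u (after f))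
  ... | inj₂ (after f) = after (E-cast (cong suc (sym p₄≡)) f)

-- Rotation by one point

-- When the opening bracket of (u)w moves to the far end, it becomes a closing one and its partner
-- an opening one: u(w).
ρ : Forest → Forest
ρ ε         = ε
ρ (⟨ u ⟩ w) = u ++ ⟨ w ⟩ ε

-- The new position of a point after rotation: 0 becomes 2n-1.
ω : ℕ → ℕ → ℕ
ω n zero    = pred (2 * n)
ω n (suc i) = i

size-ρ : ∀ F → size (ρ F) ≡ size F
size-ρ ε         = refl
size-ρ (⟨ u ⟩ w) =
  trans (size-++ u (⟨ w ⟩ ε)) (trans (+-suc (size u) _) (cong (λ s → suc (size u + s)) (+-identityʳ _)))

ω0≡end : ∀ u w → end (suc (end 0 u)) w ≡ ω (size (⟨ u ⟩ w)) 0
ω0≡end u w = cong pred (begin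
  suc (end (suc (end 0 u)) w)    ≡⟨ end-suc _ w ⟨
  end (suc (suc (end 0 u))) w    ≡⟨ cong (λ b → end (suc b) w) (end-suc 0 u) ⟨
  end 0 (⟨ u ⟩ w)                ≡⟨ end-size 0 (⟨ u ⟩ w) ⟩
  2 * size (⟨ u ⟩ w) + 0         ≡⟨ +-identityʳ _ ⟩
  2 * size (⟨ u ⟩ w)             ∎)
  where open ≡-Reasoning

E-ρ : ∀ {F n x y} → size F ≡ n → E 0 F x y → E 0 (ρ F) (ω n x) (ω n y)
E-ρ refl (opens {u} {w} refl refl) =
  E-++ʳ u (closes (sym (ω0≡end u w)) (cong (ω (size (⟨ u ⟩ w))) (end-suc 0 u)))
E-ρ refl (closes {u} {w} refl refl) =
  E-++ʳ u (opens (cong (ω (size (⟨ u ⟩ w))) (end-suc 0 u)) (sym (ω0≡end u w)))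
E-ρ refl (inside e) with E-suc⁻ e
... | _ , _ , refl , refl , f = E-++ˡ f
E-ρ refl (after {u} e) with E-suc⁻ (E-cast (cong suc (end-suc 0 u)) e)
... | _ , _ , refl , refl , f = E-++ʳ u (inside f)

E-ρ⁻ : ∀ {F n x y} → size F ≡ n → E 0 (ρ F) x y →
       ∃ λ x′ → ∃ λ y′ → x ≡ ω n x′ × y ≡ ω n y′ × E 0 F x′ y′
E-ρ⁻ {⟨ u ⟩ w} refl e with E-++⁻ u e
... | inj₁ f = _ , _ , refl , refl , inside (E-suc f)
... | inj₂ (opens refl refl) =
      _ , _ , refl , ω0≡end u w , closes (sym (end-suc 0 u)) refl
... | inj₂ (closes refl refl) =
      _ , _ , ω0≡end u w , refl , opens refl (sym (end-suc 0 u))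
... | inj₂ (inside f) = _ , _ , refl , refl , after (E-cast (cong suc (sym (end-suc 0 u))) (E-suc f))

pred-≤-+ : ∀ n {p q} → suc q ≤ n + suc p → q ≤ n + p
pred-≤-+ n {p} {q} q<n+1+p = s≤s⁻¹ (subst (suc q ≤_) (+-suc n p) q<n+1+p)

-- If 0 is not a corner, all corners drop by one. If `p₁` is 0, it becomes the last corner, so the
-- corners are renamed cyclically and the two pairings swap roles.
Flip-ρ : ∀ {n F G} → Flip n F G → Flip n (ρ F) (ρ G)
Flip-ρ {n} {F} {G} (mkFlip sF sG {suc p₁} {suc p₂} {suc p₃} {suc p₄} <₁ <₂ <₃ pairs empty agree a₁ a₂ a₃ a₄) =
  mkFlip (trans (size-ρ F) sF) (trans (size-ρ G) sG)
    (s≤s⁻¹ <₁) (s≤s⁻¹ <₂) (s≤s⁻¹ <₃) (map pairs) empty′ agree′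
    (pred-≤-+ n a₁) (pred-≤-+ n a₂) (pred-≤-+ n a₃) (s≤s⁻¹ (subst (_≤ suc p₄) (+-suc n p₁) a₄))
  where
  l = pred (2 * n)
  p₄<l : p₄ < l
  p₄<l = pred-mono-≤ (E-bound sF (proj₂ (last-matched pairs)))
  map : _ → _
  map (inj₁ ((a , b) , (c , d))) = inj₁ ((E-ρ sF a , E-ρ sF b) , (E-ρ sG c , E-ρ sG d))
  map (inj₂ ((a , b) , (c , d))) = inj₂ ((E-ρ sF a , E-ρ sF b) , (E-ρ sG c , E-ρ sG d))
  -- Point 0 jumps to the far end but stays in the arc that wraps around.
  outer : ∀ x → x < suc p₁ ⊎ suc p₄ < x → ω n x < p₁ ⊎ p₄ < ω n x
  outer zero    _                = inj₂ p₄<l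
  outer (suc x) (inj₁ (s≤s x<p)) = inj₁ x<p
  outer (suc x) (inj₂ (s≤s p<x)) = inj₂ p<x
  arc : ∀ x y → Arc (suc p₁) (suc p₂) (suc p₃) (suc p₄) x y → Arc p₁ p₂ p₃ p₄ (ω n x) (ω n y)
  arc (suc x) (suc y) (inj₁ (s≤s a , s≤s b , s≤s c , s≤s d)) = inj₁ (a , b , c , d)
  arc (suc x) (suc y) (inj₂ (inj₁ (s≤s a , s≤s b , s≤s c , s≤s d))) = inj₂ (inj₁ (a , b , c , d))
  arc (suc x) (suc y) (inj₂ (inj₂ (inj₁ (s≤s a , s≤s b , s≤s c , s≤s d)))) =
    inj₂ (inj₂ (inj₁ (a , b , c , d)))
  arc x y (inj₂ (inj₂ (inj₂ (a , b)))) = inj₂ (inj₂ (inj₂ (outer x a , outer y b)))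
  off : ∀ {x} → Off p₁ p₂ p₃ p₄ (ω n x) → Off (suc p₁) (suc p₂) (suc p₃) (suc p₄) x
  off (a , b , c , d) =
    (λ { refl → a refl }) , (λ { refl → b refl }) , (λ { refl → c refl }) , (λ { refl → d refl })
  empty′ : ∀ {x y} → E 0 (ρ F) x y → Off p₁ p₂ p₃ p₄ x → Arc p₁ p₂ p₃ p₄ x y
  empty′ e o with E-ρ⁻ {F} sF e
  ... | x , y , refl , refl , f = arc x y (empty f (off o))
  agree′ : ∀ {x y} → E 0 (ρ F) x y → Off p₁ p₂ p₃ p₄ x → E 0 (ρ G) x y
  agree′ e o with E-ρ⁻ {F} sF e
  ... | x , y , refl , refl , f = E-ρ sG (agree f (off o))
Flip-ρ {n} {F} {G} (mkFlip sF sG {zero} {suc p₂} {suc p₃} {suc p₄} <₁ <₂ <₃ pairs empty agree a₁ a₂ a₃ a₄) =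
  mkFlip (trans (size-ρ F) sF) (trans (size-ρ G) sG)
    (s≤s⁻¹ <₂) (s≤s⁻¹ <₃) p₄<l (map pairs) empty′ agree′
    (pred-≤-+ n a₂) (pred-≤-+ n a₃) last₁ last₂
  where
  l = pred (2 * n)
  p₄<l : p₄ < l
  p₄<l = pred-mono-≤ (E-bound sF (proj₂ (last-matched pairs)))
  suc-l : suc l ≡ n + n
  suc-l = trans (suc-pred (2 * n) {{>-nonZero (<-trans z<s (E-bound sF (proj₂ (last-matched pairs))))}}) (cong (n +_) (+-identityʳ n))
  -- The arcs at the moved corner trade forms: the wrapping bound `a₄` becomes an ordinary one, and
  -- `a₁` becomes the wrapping one.
  last₁ : l ≤ n + p₄
  last₁ = s≤s⁻¹ (subst₂ _≤_ (sym suc-l) (+-suc n p₄) (+-monoʳ-≤ n (subst (_≤ suc p₄) (+-identityʳ n) a₄)))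
  last₂ : n + p₂ ≤ l
  last₂ = s≤s⁻¹ (subst₂ _≤_ (+-suc n p₂) (sym suc-l) (+-monoʳ-≤ n (subst (suc p₂ ≤_) (+-identityʳ n) a₁)))
  map : _ → _
  map (inj₁ ((a , b) , (c , d))) =
    inj₂ ((E-sym (E-ρ sF a) , E-ρ sF b) , (E-ρ sG d , E-sym (E-ρ sG c)))
  map (inj₂ ((a , b) , (c , d))) =
    inj₁ ((E-ρ sF b , E-sym (E-ρ sF a)) , (E-sym (E-ρ sG c) , E-ρ sG d))
  arc : ∀ x y → x < 2 * n → y < 2 * n → Arc 0 (suc p₂) (suc p₃) (suc p₄) x y → Arc p₂ p₃ p₄ l (ω n x) (ω n y)
  arc (suc x) (suc y) _ _ (inj₁ (_ , s≤s b , _ , s≤s d)) = inj₂ (inj₂ (inj₂ (inj₁ b , inj₁ d)))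
  arc (suc x) (suc y) _ _ (inj₂ (inj₁ (s≤s a , s≤s b , s≤s c , s≤s d))) = inj₁ (a , b , c , d)
  arc (suc x) (suc y) _ _ (inj₂ (inj₂ (inj₁ (s≤s a , s≤s b , s≤s c , s≤s d)))) =
    inj₂ (inj₁ (a , b , c , d))
  arc (suc x) (suc y) x< y< (inj₂ (inj₂ (inj₂ (inj₂ (s≤s a) , inj₂ (s≤s b))))) =
    inj₂ (inj₂ (inj₁ (a , pred-mono-≤ x< , b , pred-mono-≤ y<)))
  off : ∀ {x} → Off p₂ p₃ p₄ l (ω n x) → Off 0 (suc p₂) (suc p₃) (suc p₄) x
  off (a , b , c , d) =
    (λ { refl → d refl }) , (λ { refl → a refl }) , (λ { refl → b refl }) , (λ { refl → c refl })
  empty′ : ∀ {x y} → E 0 (ρ F) x y → Off p₂ p₃ p₄ l x → Arc p₂ p₃ p₄ l x y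
  empty′ e o with E-ρ⁻ {F} sF e
  ... | x , y , refl , refl , f = arc x y (E-bound sF f) (E-bound sF (E-sym f)) (empty f (off o))
  agree′ : ∀ {x y} → E 0 (ρ F) x y → Off p₂ p₃ p₄ l x → E 0 (ρ G) x y
  agree′ e o with E-ρ⁻ {F} sF e
  ... | x , y , refl , refl , f = E-ρ sG (agree f (off o))

-- Inserting a pair of antipodal boundary edges

-- The new `()` occupies p and p + 1. A bracket standing at p itself comes behind it, in accordance
-- with `bump`, which moves every position from p on by two.
ins : ℕ → ℕ → Forest → Forest
ins a p ε = ⟨ ε ⟩ ε
ins a p (⟨ u ⟩ w) with p ≤? a
... | yes _ = ⟨ ε ⟩ ⟨ u ⟩ w
... | no _ with p ≤? end (suc a) u
...   | yes _ = ⟨ ins (suc a) p u ⟩ w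
...   | no _  = ⟨ u ⟩ ins (suc (end (suc a) u)) p w

bump : ℕ → ℕ → ℕ
bump p i with i <? p
... | yes _ = i
... | no _  = 2 + i

bump-< : ∀ {p i} → i < p → bump p i ≡ i
bump-< {p} {i} i<p with i <? p
... | yes _  = refl
... | no i≮p = ⊥-elim (i≮p i<p)

bump-≥ : ∀ {p i} → p ≤ i → bump p i ≡ 2 + i
bump-≥ {p} {i} p≤i with i <? p
... | yes i<p = ⊥-elim (<⇒≱ i<p p≤i)
... | no _    = refl

bump-gap : ∀ p i → bump p i < p ⊎ suc p < bump p i
bump-gap p i with i <? p
... | yes i<p = inj₁ i<p
... | no i≮p  = inj₂ (s≤s (s≤s (≮⇒≥ i≮p)))

bump-lower : ∀ p i → i ≤ bump p i
bump-lower p i with i <? p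
... | yes _ = ≤-refl
... | no _  = m≤n+m i 2

bump-upper : ∀ p i → bump p i ≤ 2 + i
bump-upper p i with i <? p
... | yes _ = m≤n+m i 2
... | no _  = ≤-refl

bump-mono-< : ∀ p {i j} → i < j → bump p i < bump p j
bump-mono-< p {i} {j} i<j with i <? p
... | yes _  = <-≤-trans i<j (bump-lower p j)
... | no i≮p = subst (2 + i <_) (sym (bump-≥ (≤-trans (≮⇒≥ i≮p) (<⇒≤ i<j)))) (s≤s (s≤s i<j))

size-ins : ∀ a p F → size (ins a p F) ≡ suc (size F)
size-ins a p ε = refl
size-ins a p (⟨ u ⟩ w) with p ≤? a
... | yes _ = refl
... | no _ with p ≤? end (suc a) u
...   | yes _ = cong (λ s → suc (s + size w)) (size-ins (suc a) p u)
...   | no _  = cong suc (trans (cong (size u +_) (size-ins _ p w)) (+-suc (size u) (size w)))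

end-ins : ∀ a p F → end a (ins a p F) ≡ 2 + end a F
end-ins a p F = begin
  end a (ins a p F)           ≡⟨ end-size a (ins a p F) ⟩
  2 * size (ins a p F) + a    ≡⟨ cong (λ s → 2 * s + a) (size-ins a p F) ⟩
  2 * suc (size F) + a        ≡⟨ cong (_+ a) (*-suc 2 (size F)) ⟩
  2 + (2 * size F + a)        ≡⟨ cong (2 +_) (end-size a F) ⟨
  2 + end a F                 ∎
  where open ≡-Reasoning

E-cast₂ : ∀ {a F i j i′ j′} → i ≡ i′ → j ≡ j′ → E a F i j → E a F i′ j′
E-cast₂ refl refl e = e

E-2+ : ∀ {a p F i j} → p ≤ a → E a F i j → E (2 + a) F (bump p i) (bump p j)
E-2+ p≤a e =
  E-cast₂ (sym (bump-≥ (≤-trans p≤a (E-lower e)))) (sym (bump-≥ (≤-trans p≤a (E-lower (E-sym e)))))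
          (E-suc (E-suc e))

E-ins : ∀ {a p F i j} → a ≤ p → p ≤ end a F → E a F i j → E a (ins a p F) (bump p i) (bump p j)
E-ins {a} {p} {⟨ u ⟩ w} a≤p p≤b e with p ≤? a
... | yes p≤a = after (E-2+ p≤a e)
... | no p≰a with p ≤? end (suc a) u
E-ins {a} {p} {⟨ u ⟩ w} a≤p p≤b (opens refl refl) | no p≰a | yes p≤c =
  opens (bump-< (≰⇒> p≰a)) (trans (bump-≥ p≤c) (sym (end-ins (suc a) p u)))
E-ins {a} {p} {⟨ u ⟩ w} a≤p p≤b (closes refl refl) | no p≰a | yes p≤c =
  closes (trans (bump-≥ p≤c) (sym (end-ins (suc a) p u))) (bump-< (≰⇒> p≰a))
E-ins {a} {p} {⟨ u ⟩ w} a≤p p≤b (inside e) | no p≰a | yes p≤c = inside (E-ins (≰⇒> p≰a) p≤c e)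
E-ins {a} {p} {⟨ u ⟩ w} a≤p p≤b (after e) | no p≰a | yes p≤c =
  after (E-cast (cong suc (sym (end-ins (suc a) p u))) (E-2+ (m≤n⇒m≤1+n p≤c) e))
E-ins {a} {p} {⟨ u ⟩ w} a≤p p≤b (opens refl refl) | no p≰a | no p≰c =
  opens (bump-< (≰⇒> p≰a)) (bump-< (≰⇒> p≰c))
E-ins {a} {p} {⟨ u ⟩ w} a≤p p≤b (closes refl refl) | no p≰a | no p≰c =
  closes (bump-< (≰⇒> p≰c)) (bump-< (≰⇒> p≰a))
E-ins {a} {p} {⟨ u ⟩ w} a≤p p≤b (inside e) | no p≰a | no p≰c =
  inside (E-cast₂ (sym (bump-< (<-trans (E-upper e) (≰⇒> p≰c))))
                  (sym (bump-< (<-trans (E-upper (E-sym e)) (≰⇒> p≰c)))) e)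
E-ins {a} {p} {⟨ u ⟩ w} a≤p p≤b (after e) | no p≰a | no p≰c = after (E-ins (≰⇒> p≰c) p≤b e)

E-ins-new : ∀ a p F → a ≤ p → p ≤ end a F → E a (ins a p F) p (suc p)
E-ins-new a p ε a≤p p≤a = opens (≤-antisym p≤a a≤p) (cong suc (≤-antisym p≤a a≤p))
E-ins-new a p (⟨ u ⟩ w) a≤p p≤b with p ≤? a
... | yes p≤a = opens (≤-antisym p≤a a≤p) (cong suc (≤-antisym p≤a a≤p))
... | no p≰a with p ≤? end (suc a) u
...   | yes p≤c = inside (E-ins-new (suc a) p u (≰⇒> p≰a) p≤c)
...   | no p≰c  = after (E-ins-new _ p w (≰⇒> p≰c) p≤b)

-- All brackets of v stand strictly before `end a v`, so insertion passes over every one of them.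
ins-++ : ∀ a p v w → end a v ≤ p → ins a p (v ++ w) ≡ v ++ ins (end a v) p w
ins-++ a p ε w _ = refl
ins-++ a p (⟨ u ⟩ v) w b≤p with p ≤? a
... | yes p≤a = ⊥-elim (<⇒≱ (<-≤-trans (start≤end (suc a) u)
                  (≤-trans (<⇒≤ (start≤end _ v)) b≤p)) p≤a)
... | no _ with p ≤? end (suc a) u
...   | yes p≤c = ⊥-elim (<⇒≱ (start≤end _ v) (≤-trans b≤p p≤c))
...   | no _    = cong (⟨ u ⟩_) (ins-++ _ p v w b≤p)

ins-here : ∀ a F → ins a a F ≡ ⟨ ε ⟩ F
ins-here a ε = refl
ins-here a (⟨ u ⟩ w) with a ≤? a
... | yes _  = refl
... | no a≰a = ⊥-elim (a≰a ≤-refl)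

ins-inside : ∀ a p u w → a < p → p ≤ end (suc a) u → ins a p (⟨ u ⟩ w) ≡ ⟨ ins (suc a) p u ⟩ w
ins-inside a p u w a<p p≤c with p ≤? a
... | yes p≤a = ⊥-elim (<⇒≱ a<p p≤a)
... | no _ with p ≤? end (suc a) u
...   | yes _  = refl
...   | no p≰c = ⊥-elim (p≰c p≤c)

-- For W with n edges this has antipodal boundary edges {0, 1} and {n + 2, n + 3}.
lift : ℕ → Forest → Forest
lift n W = ⟨ ε ⟩ ins 2 (2 + n) W

-- The new place of point i: the edge at 0 shifts every point by two, the edge at n + 2 shifts those
-- with n ≤ i by two more.
ι : ℕ → ℕ → ℕ
ι n i = bump (2 + n) (2 + i)

size-lift : ∀ {n} W → size W ≡ n → size (lift n W) ≡ 2 + n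
size-lift {n} W refl = cong suc (size-ins 2 (2 + n) W)

n+2≤end : ∀ {n} W → size W ≡ n → 2 + n ≤ end 2 W
n+2≤end {n} W refl = subst (2 + n ≤_) (trans (+-comm 2 _) (sym (end-size 2 W)))
                       (+-monoʳ-≤ 2 (m≤m+n n _))

E-lift : ∀ {n W i j} → size W ≡ n → E 0 W i j → E 0 (lift n W) (ι n i) (ι n j)
E-lift {W = W} s e = after (E-ins (s≤s (s≤s z≤n)) (n+2≤end W s) (E-suc (E-suc e)))

E-lift-new : ∀ {n} W → size W ≡ n → E 0 (lift n W) (2 + n) (3 + n)
E-lift-new W s = after (E-ins-new 2 _ W (s≤s (s≤s z≤n)) (n+2≤end W s))

data LiftedEdge (n : ℕ) (W : Forest) : ℕ → ℕ → Set where
  first₁ : LiftedEdge n W 0 1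
  first₂ : LiftedEdge n W 1 0
  mid₁   : LiftedEdge n W (2 + n) (3 + n)
  mid₂   : LiftedEdge n W (3 + n) (2 + n)
  old    : ∀ {i j} → E 0 W i j → LiftedEdge n W (ι n i) (ι n j)

-- Insertion need not be inverted: apart from the four new points, x is `ι n` of a point of W, whose
-- edge lifts by `E-lift`, and functionality identifies the partners.
E-lift⁻ : ∀ {n W x y} → size W ≡ n → E 0 (lift n W) x y → LiftedEdge n W x y
E-lift⁻ s (opens refl refl) = first₁
E-lift⁻ s (closes refl refl) = first₂
E-lift⁻ {n} {W} {x} {y} s e@(after f) with <-cmp x (2 + n)
... | tri≈ _ refl _ with E-functional e (E-lift-new W s)
...   | refl = mid₁
E-lift⁻ {n} {W} {x} {y} s e@(after f) | tri< x<p _ _ = lower x x<p (E-lower f) e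
  where
  lower : ∀ x → x < 2 + n → 2 ≤ x → E 0 (lift n W) x y → LiftedEdge n W x y
  lower (suc (suc x)) x<p _ e =
    let x<n = s≤s⁻¹ (s≤s⁻¹ x<p)
        j , g = E-at W s (<-≤-trans x<n (m≤m+n n _))
        eq = bump-< x<p
    in subst₂ (LiftedEdge n W) eq (E-functional (E-lift s g) (E-cast₂ (sym eq) refl e)) (old g)
  lower (suc zero) _ (s≤s ()) _
E-lift⁻ {n} {W} {x} {y} s e@(after f) | tri> _ _ p<x with 3 + n ≟ x
... | yes refl with E-functional e (E-sym (E-lift-new W s))
...   | refl = mid₂
E-lift⁻ {n} {W} {x} {y} s e@(after f) | tri> _ _ p<x | no ≢x =
  upper x (≤∧≢⇒< p<x ≢x) (E-bound (size-lift W s) e) e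
  where
  double : ∀ n → 2 * (2 + n) ≡ 4 + 2 * n
  double = solve-∀
  upper : ∀ x → 3 + n < x → x < 2 * (2 + n) → E 0 (lift n W) x y → LiftedEdge n W x y
  upper (suc (suc (suc (suc x)))) (s≤s (s≤s p<x)) x<b e =
    let j , g = E-at W s (+-cancelˡ-< 4 x (2 * n) (subst (4 + x <_) (double n) x<b))
        eq = bump-≥ p<x
    in subst₂ (LiftedEdge n W) eq (E-functional (E-lift s g) (E-cast₂ (sym eq) refl e)) (old g)
  upper (suc (suc (suc zero))) (s≤s (s≤s (s≤s ())))

Arc-map : ∀ (f : ℕ → ℕ) → (∀ {i j} → i < j → f i < f j) → ∀ {p₁ p₂ p₃ p₄ x y} →
          Arc p₁ p₂ p₃ p₄ x y → Arc (f p₁) (f p₂) (f p₃) (f p₄) (f x) (f y)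
Arc-map f mono (inj₁ (a , b , c , d)) = inj₁ (mono a , mono b , mono c , mono d)
Arc-map f mono (inj₂ (inj₁ (a , b , c , d))) = inj₂ (inj₁ (mono a , mono b , mono c , mono d))
Arc-map f mono (inj₂ (inj₂ (inj₁ (a , b , c , d)))) =
  inj₂ (inj₂ (inj₁ (mono a , mono b , mono c , mono d)))
Arc-map f mono (inj₂ (inj₂ (inj₂ (a , b)))) = inj₂ (inj₂ (inj₂ (side a , side b)))
  where
  side : ∀ {p q z} → z < p ⊎ q < z → f z < f p ⊎ f q < f z
  side (inj₁ a) = inj₁ (mono a)
  side (inj₂ a) = inj₂ (mono a)

Arc-sym : ∀ {p₁ p₂ p₃ p₄ x y} → Arc p₁ p₂ p₃ p₄ x y → Arc p₁ p₂ p₃ p₄ y x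
Arc-sym (inj₁ (a , b , c , d)) = inj₁ (c , d , a , b)
Arc-sym (inj₂ (inj₁ (a , b , c , d))) = inj₂ (inj₁ (c , d , a , b))
Arc-sym (inj₂ (inj₂ (inj₁ (a , b , c , d)))) = inj₂ (inj₂ (inj₁ (c , d , a , b)))
Arc-sym (inj₂ (inj₂ (inj₂ (a , b)))) = inj₂ (inj₂ (inj₂ (b , a)))

-- No corner lies at x or x + 1, so nothing separates the two; comparing with the corners finds
-- their common arc.
Arc-adjacent : ∀ {p₁ p₂ p₃ p₄ x} → p₁ < x ⊎ suc x < p₁ → p₂ < x ⊎ suc x < p₂ →
               p₃ < x ⊎ suc x < p₃ → p₄ < x ⊎ suc x < p₄ → Arc p₁ p₂ p₃ p₄ x (suc x)
Arc-adjacent _ _ _ (inj₁ d) = inj₂ (inj₂ (inj₂ (inj₂ d , inj₂ (m≤n⇒m≤1+n d))))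
Arc-adjacent (inj₂ a) _ _ _ = inj₂ (inj₂ (inj₂ (inj₁ (<⇒≤ a) , inj₁ a)))
Arc-adjacent _ _ (inj₁ c) (inj₂ d) = inj₂ (inj₂ (inj₁ (c , <⇒≤ d , m≤n⇒m≤1+n c , d)))
Arc-adjacent _ (inj₁ b) (inj₂ c) _ = inj₂ (inj₁ (b , <⇒≤ c , m≤n⇒m≤1+n b , c))
Arc-adjacent (inj₁ a) (inj₂ b) _ _ = inj₁ (a , <⇒≤ b , m≤n⇒m≤1+n a , b)

-- The permitted arc length grows by two, so no arc may gain both new edges. The first three arcs
-- never contain the edge at 0; the wrapping arc does, and the antipodal position keeps the other
-- edge out of it. Joining neighbours, the new edges leave the quadrilateral empty.
Flip-lift : ∀ {n F G} → Flip n F G → Flip (2 + n) (lift n F) (lift n G)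
Flip-lift {n} {F} {G} (mkFlip sF sG {p₁} {p₂} {p₃} {p₄} <₁ <₂ <₃ pairs empty agree a₁ a₂ a₃ a₄) =
  mkFlip (size-lift F sF) (size-lift G sG) (mono <₁) (mono <₂) (mono <₃)
    (map pairs) empty′ agree′ (arc p₁ p₂ a₁) (arc p₂ p₃ a₂) (arc p₃ p₄ a₃) arc′
  where
  f = ι n
  mono : ∀ {i j} → i < j → f i < f j
  mono i<j = bump-mono-< (2 + n) (s≤s (s≤s i<j))
  map : _ → _
  map (inj₁ ((a , b) , (c , d))) = inj₁ ((E-lift sF a , E-lift sF b) , (E-lift sG c , E-lift sG d))
  map (inj₂ ((a , b) , (c , d))) = inj₂ ((E-lift sF a , E-lift sF b) , (E-lift sG c , E-lift sG d))
  off : ∀ {x} → Off (f p₁) (f p₂) (f p₃) (f p₄) (f x) → Off p₁ p₂ p₃ p₄ x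
  off (a , b , c , d) =
    (λ { refl → a refl }) , (λ { refl → b refl }) , (λ { refl → c refl }) , (λ { refl → d refl })
  2≤ : ∀ i → 2 ≤ f i
  2≤ i = ≤-trans (s≤s (s≤s z≤n)) (bump-lower (2 + n) (2 + i))
  first : Arc (f p₁) (f p₂) (f p₃) (f p₄) 0 1
  first = Arc-adjacent (inj₂ (2≤ p₁)) (inj₂ (2≤ p₂)) (inj₂ (2≤ p₃)) (inj₂ (2≤ p₄))
  gap : ∀ i → f i < 2 + n ⊎ 3 + n < f i
  gap i = bump-gap (2 + n) (2 + i)
  mid : Arc (f p₁) (f p₂) (f p₃) (f p₄) (2 + n) (3 + n)
  mid = Arc-adjacent (gap p₁) (gap p₂) (gap p₃) (gap p₄)
  empty′ : ∀ {x y} → E 0 (lift n F) x y → Off (f p₁) (f p₂) (f p₃) (f p₄) x →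
           Arc (f p₁) (f p₂) (f p₃) (f p₄) x y
  empty′ e o with E-lift⁻ sF e
  ... | first₁ = first
  ... | first₂ = Arc-sym first
  ... | mid₁   = mid
  ... | mid₂   = Arc-sym mid
  ... | old g  = Arc-map f mono (empty g (off o))
  agree′ : ∀ {x y} → E 0 (lift n F) x y → Off (f p₁) (f p₂) (f p₃) (f p₄) x → E 0 (lift n G) x y
  agree′ e o with E-lift⁻ sF e
  ... | first₁ = opens refl refl
  ... | first₂ = closes refl refl
  ... | mid₁   = E-lift-new G sG
  ... | mid₂   = E-sym (E-lift-new G sG)
  ... | old g  = E-lift sG (agree g (off o))
  arc : ∀ p q → q ≤ n + p → f q ≤ (2 + n) + f p
  arc p q q≤ = ≤-trans (bump-upper (2 + n) (2 + q))
    (≤-trans (+-monoʳ-≤ 4 q≤) (≤-trans (≤-reflexive (lem n p))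
      (+-monoʳ-≤ (2 + n) (bump-lower (2 + n) (2 + p)))))
    where
    lem : ∀ n p → 4 + (n + p) ≡ (2 + n) + (2 + p)
    lem = solve-∀
  -- The two gaps are n apart, so p₁ lies before the second one and p₄ behind it.
  p₁<n : p₁ < n
  p₁<n = +-cancelˡ-< n p₁ n
    (≤-<-trans a₄ (subst (p₄ <_) (cong (n +_) (+-identityʳ n)) (E-bound sF (proj₂ (last-matched pairs)))))
  arc′ : (2 + n) + f p₁ ≤ f p₄
  arc′ = subst₂ (λ a b → (2 + n) + a ≤ b)
    (sym (bump-< (s≤s (s≤s p₁<n)))) (sym (bump-≥ (s≤s (s≤s (≤-trans (m≤m+n n p₁) a₄)))))
    (≤-trans (≤-reflexive (lem n p₁)) (+-monoʳ-≤ 4 a₄))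
    where
    lem : ∀ n p → (2 + n) + (2 + p) ≡ 4 + (n + p)
    lem = solve-∀

-- Connectivity of forests under centered flips

_~[_]_ : Forest → ℕ → Forest → Set
F ~[ n ] G = Star (Flip n) F G

infix 4 _~[_]_

~-reflexive : ∀ {n F G} → F ≡ G → F ~[ n ] G
~-reflexive refl = done

~-sym : ∀ {n F G} → F ~[ n ] G → G ~[ n ] F
~-sym = reverse Flip-sym

ρ^ : ℕ → Forest → Forest
ρ^ zero    F = F
ρ^ (suc k) F = ρ^ k (ρ F)

ρ^-+ : ∀ j k F → ρ^ (j + k) F ≡ ρ^ k (ρ^ j F)
ρ^-+ zero    k F = refl
ρ^-+ (suc j) k F = ρ^-+ j k (ρ F)

-- The first tree goes to the back in stages: its opening bracket by one rotation, its content by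
-- induction, its closing bracket by another rotation. The remaining trees follow.
ρ^-++ : ∀ u w → ρ^ (2 * size u) (u ++ w) ≡ w ++ u
ρ^-++ ε         w = sym (++-identityʳ w)
ρ^-++ (⟨ t ⟩ u) w = begin
  ρ^ (2 * suc (size t + size u)) (⟨ t ⟩ (u ++ w))
    ≡⟨ cong (λ k → ρ^ k (⟨ t ⟩ (u ++ w))) (arith (size t) (size u)) ⟩
  ρ^ (2 * size t + suc (2 * size u)) (t ++ ⟨ u ++ w ⟩ ε)
    ≡⟨ ρ^-+ (2 * size t) (suc (2 * size u)) _ ⟩
  ρ^ (suc (2 * size u)) (ρ^ (2 * size t) (t ++ ⟨ u ++ w ⟩ ε))
    ≡⟨ cong (ρ^ (suc (2 * size u))) (ρ^-++ t (⟨ u ++ w ⟩ ε)) ⟩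
  ρ^ (2 * size u) ((u ++ w) ++ ⟨ t ⟩ ε)
    ≡⟨ cong (ρ^ (2 * size u)) (++-assoc u w (⟨ t ⟩ ε)) ⟩
  ρ^ (2 * size u) (u ++ (w ++ ⟨ t ⟩ ε))
    ≡⟨ ρ^-++ u (w ++ ⟨ t ⟩ ε) ⟩
  (w ++ ⟨ t ⟩ ε) ++ u
    ≡⟨ ++-assoc w (⟨ t ⟩ ε) u ⟩
  w ++ ⟨ t ⟩ u ∎
  where
  open ≡-Reasoning
  arith : ∀ a b → 2 * (1 + (a + b)) ≡ 1 + (2 * a + (1 + 2 * b))
  arith = solve-∀

~-ρ : ∀ {n F G} → F ~[ n ] G → ρ F ~[ n ] ρ G
~-ρ = gmap ρ Flip-ρ

~-ρ^ : ∀ k {n F G} → F ~[ n ] G → ρ^ k F ~[ n ] ρ^ k G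
~-ρ^ zero    p = p
~-ρ^ (suc k) p = ~-ρ^ k (~-ρ p)

-- Both ends of the path undergo the same number of rotations, hence the prefixes need equal size.
~-rotate : ∀ {n} u u′ w w′ → size u ≡ size u′ → u ++ w ~[ n ] u′ ++ w′ → w ++ u ~[ n ] w′ ++ u′
~-rotate {n} u u′ w w′ s p =
  subst₂ (_~[ n ]_) (ρ^-++ u w)
    (trans (cong (λ k → ρ^ (2 * k) (u′ ++ w′)) s) (ρ^-++ u′ w′))
    (~-ρ^ (2 * size u) p)

-- Trees are counted off until their edges exceed H; that tree is `⟨ z ⟩`. In the recursion k is
-- what remains of H.
split : ∀ H v → H < size v →
        ∃ λ v′ → ∃ λ z → ∃ λ t → v ≡ v′ ++ ⟨ z ⟩ t × size v′ ≤ H × H ≤ size v′ + size z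
split H (⟨ z ⟩ w) H<v with H ≤? size z
... | yes H≤z = ε , z , w , refl , z≤n , H≤z
... | no H≰z with m≤n⇒∃[o]m+o≡n (≰⇒> H≰z)
...   | k , refl with split k w (+-cancelˡ-< (suc (size z)) k (size w) H<v)
...     | v′ , z′ , t , refl , v′≤k , k≤ =
  ⟨ z ⟩ v′ , z′ , t , refl , +-monoʳ-≤ (suc (size z)) v′≤k ,
  ≤-trans (+-monoʳ-≤ (suc (size z)) k≤) (≤-reflexive (sym (+-assoc (suc (size z)) (size v′) (size z′))))

-- The condition |v| ≤ |x| makes the second flip centered: one of its arcs holds y()v, with |y| + 1
-- + |v| ≤ |y| + 1 + |x| = H edges.
open-diameter : ∀ {H} v z x y → size (⟨ v ⟩ z) ≡ H → size (⟨ x ⟩ y) ≡ H → size v ≤ size x →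
  ⟨ ⟨ v ⟩ z ⟩ ⟨ x ⟩ y ~[ suc (2 * H) ] ⟨ ε ⟩ (v ++ ⟨ z ++ ⟨ ε ⟩ x ⟩ y)
open-diameter {H} v z x y refl s v≤x =
  -- A merge with empty first tree, read backwards. The diameter is a side of its quadrilateral,
  -- with exactly H edges beyond it.
  Flip-sym (merge ε v z (⟨ x ⟩ y) z≤n (m≤n⇒m≤1+n (m≤m+n _ _)) (m≤n⇒m≤1+n (m≤n+m _ _)) (≤-reflexive s) size₁)
  -- To merge `(z)` with `(x)`, the prefix `()v` is first rotated to the back.
  ◅ ~-rotate (⟨ z ⟩ ⟨ x ⟩ y) (⟨ z ++ ⟨ ε ⟩ x ⟩ y) (⟨ ε ⟩ v) (⟨ ε ⟩ v) size₂
      (merge z ε x (y ++ ⟨ ε ⟩ v) (m≤n⇒m≤1+n (m≤n+m _ _)) z≤n x≤H y≤H size₃ ◅ done)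
  where
  size₁ : size (⟨ ε ⟩ (v ++ ⟨ z ⟩ ⟨ x ⟩ y)) ≡ suc (2 * H)
  size₁ = cong suc (trans (size-++ v (⟨ z ⟩ ⟨ x ⟩ y))
    (trans (lem (size v) (size z) (size (⟨ x ⟩ y))) (cong (λ s → H + s) (trans s (sym (+-identityʳ H))))))
    where
    lem : ∀ a b c → a + (1 + (b + c)) ≡ (1 + (a + b)) + c
    lem = solve-∀
  size₂ : size (⟨ z ⟩ ⟨ x ⟩ y) ≡ size (⟨ z ++ ⟨ ε ⟩ x ⟩ y)
  size₂ = cong suc (sym (trans (cong (_+ size y) (size-++ z (⟨ ε ⟩ x))) (lem (size z) (size x) (size y))))
    where
    lem : ∀ a b c → (a + (1 + b)) + c ≡ a + (1 + (b + c))
    lem = solve-∀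
  x≤H : size x ≤ H
  x≤H = ≤-trans (m≤n⇒m≤1+n (m≤m+n _ _)) (≤-reflexive s)
  y≤H : size (y ++ ⟨ ε ⟩ v) ≤ H
  y≤H = ≤-trans (≤-reflexive (trans (size-++ y (⟨ ε ⟩ v)) (+-suc (size y) (size v))))
    (≤-trans (s≤s (≤-trans (+-monoʳ-≤ (size y) v≤x) (≤-reflexive (+-comm (size y) (size x)))))
      (≤-reflexive s))
  size₃ : size (⟨ z ⟩ ⟨ x ⟩ (y ++ ⟨ ε ⟩ v)) ≡ suc (2 * H)
  size₃ = trans (cong (λ s → suc (size z + suc (size x + s))) (size-++ y (⟨ ε ⟩ v)))
    (trans (lem (size v) (size z) (size x) (size y))
      (cong (λ s → suc (H + s)) (trans s (sym (+-identityʳ H)))))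
    where
    lem : ∀ v z x y → 1 + (z + (1 + (x + (y + (1 + v))))) ≡ 1 + ((1 + (v + z)) + (1 + (x + y)))
    lem = solve-∀

-- Before x stand `()`, v, one opening bracket and z, in all 2 + 2|v| + 1 + 2|z| = 2 + n positions.
lift-split : ∀ {n} v z x y → 2 * (size v + size z) + 1 ≡ n →
             lift n (v ++ ⟨ z ++ x ⟩ y) ≡ ⟨ ε ⟩ (v ++ ⟨ z ++ ⟨ ε ⟩ x ⟩ y)
lift-split {n} v z x y refl = cong (⟨ ε ⟩_) (begin
  ins 2 p (v ++ ⟨ z ++ x ⟩ y)
    ≡⟨ ins-++ 2 p v _ (<⇒≤ b<p) ⟩
  v ++ ins b p (⟨ z ++ x ⟩ y)
    ≡⟨ cong (v ++_) (ins-inside b p (z ++ x) y b<p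
         (subst₂ _≤_ c≡p (sym (end-++ (suc b) z x)) (start≤end _ x))) ⟩
  v ++ ⟨ ins (suc b) p (z ++ x) ⟩ y
    ≡⟨ cong (λ t → v ++ ⟨ t ⟩ y) (ins-++ (suc b) p z x (≤-reflexive c≡p)) ⟩
  v ++ ⟨ z ++ ins (end (suc b) z) p x ⟩ y
    ≡⟨ cong (λ c → v ++ ⟨ z ++ ins c p x ⟩ y) c≡p ⟩
  v ++ ⟨ z ++ ins p p x ⟩ y
    ≡⟨ cong (λ t → v ++ ⟨ z ++ t ⟩ y) (ins-here p x) ⟩
  v ++ ⟨ z ++ ⟨ ε ⟩ x ⟩ y ∎)
  where
  open ≡-Reasoning
  p = 2 + n
  b = end 2 v
  c≡p : end (suc b) z ≡ p
  c≡p = trans (end-size (suc b) z) (trans (cong (λ b → 2 * size z + suc b) (end-size 2 v))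
          (lem (size v) (size z)))
    where
    lem : ∀ v z → 2 * z + (1 + (2 * v + 2)) ≡ 2 + (2 * (v + z) + 1)
    lem = solve-∀
  b<p : b < p
  b<p = subst (suc b ≤_) c≡p (start≤end (suc b) z)

replicate : ℕ → Forest
replicate zero    = ε
replicate (suc k) = ⟨ ε ⟩ replicate k

size-replicate : ∀ k → size (replicate k) ≡ k
size-replicate zero    = refl
size-replicate (suc k) = cong suc (size-replicate k)

-- Induction step from 2h + 1 to 2h + 3 edges

module Step (h : ℕ)
  (ih : ∀ F G → size F ≡ suc (2 * h) → size G ≡ suc (2 * h) → F ~[ suc (2 * h) ] G) where

  H n′ n : ℕ
  H  = suc h
  n′ = suc (2 * h)
  n  = suc (2 * H)

  n≡ : 2 + n′ ≡ n
  n≡ = cong suc (sym (*-suc 2 h))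

  -- The lifted word is left open, since the induction hypothesis joins all lifted words by
  -- `lift-connected`.
  Reaches : Forest → Set
  Reaches F = ∃ λ W → size W ≡ n′ × F ~[ n ] lift n′ W

  lift-connected : ∀ V W → size V ≡ n′ → size W ≡ n′ → lift n′ V ~[ n ] lift n′ W
  lift-connected V W sV sW =
    subst (λ n → lift n′ V ~[ n ] lift n′ W) n≡ (gmap (lift n′) Flip-lift (ih V W sV sW))

  Reaches-~ : ∀ {F G} → F ~[ n ] G → Reaches G → Reaches F
  Reaches-~ p (W , s , q) = W , s , p ◅◅ q

  antipodal-size : ∀ v z x y → size (⟨ v ⟩ z) ≡ H → size (⟨ x ⟩ y) ≡ H →
                   size (v ++ ⟨ z ++ x ⟩ y) ≡ n′
  antipodal-size v z x y p q = trans (size-++ v _)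
    (trans (cong (λ s → size v + suc (s + size y)) (size-++ z x))
    (trans (lem (size v) (size z) (size x) (size y))
    (cong₂ (λ a b → suc (a + b)) (suc-injective p)
      (trans (suc-injective q) (sym (+-identityʳ h))))))
    where
    lem : ∀ v z x y → v + (1 + ((z + x) + y)) ≡ 1 + ((v + z) + (x + y))
    lem = solve-∀

  antipodal-lift : ∀ v z x y → size (⟨ v ⟩ z) ≡ H →
                   lift n′ (v ++ ⟨ z ++ x ⟩ y) ≡ ⟨ ε ⟩ (v ++ ⟨ z ++ ⟨ ε ⟩ x ⟩ y)
  antipodal-lift v z x y p =
    lift-split v z x y (trans (+-comm _ 1) (cong (λ a → suc (2 * a)) (suc-injective p)))

  Reaches-diameter : ∀ v z x y → size (⟨ v ⟩ z) ≡ H → size (⟨ x ⟩ y) ≡ H → size v ≤ size x →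
                     Reaches (⟨ ⟨ v ⟩ z ⟩ ⟨ x ⟩ y)
  Reaches-diameter v z x y p q v≤x =
    v ++ ⟨ z ++ x ⟩ y , antipodal-size v z x y p q ,
    subst (⟨ ⟨ v ⟩ z ⟩ ⟨ x ⟩ y ~[ n ]_) (sym (antipodal-lift v z x y p))
      (open-diameter v z x y p q v≤x)

  -- One matching with a diameter both reaches the lifted matchings and is, up
  -- to one rotation, itself lifted; so rotation does not leave their component.
  Reaches-ρ : ∀ {F} → Reaches F → Reaches (ρ F)
  Reaches-ρ {F} (W , s , p) with Reaches-diameter ε A ε A sA sA z≤n
    where
    A = replicate h
    sA : size (⟨ ε ⟩ A) ≡ H
    sA = cong suc (size-replicate h)
  ... | V , sV , q =
    -- The word ()A(()A) is at once the rotation of (()A)()A and the lift of A(A).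
    A ++ ⟨ A ⟩ ε , antipodal-size A ε A ε sA′ sA′ ,
    ~-ρ p ◅◅ ~-ρ (lift-connected W V s sV) ◅◅ ~-ρ (~-sym q)
      ◅◅ ~-reflexive (sym (antipodal-lift A ε A ε sA′))
    where
    A = replicate h
    sA′ : size (⟨ A ⟩ ε) ≡ H
    sA′ = cong suc (trans (+-identityʳ _) (size-replicate h))

  Reaches-ρ^ : ∀ k {F} → Reaches F → Reaches (ρ^ k F)
  Reaches-ρ^ zero    r = r
  Reaches-ρ^ (suc k) r = Reaches-ρ^ k (Reaches-ρ r)

  Reaches-rotate : ∀ u w → Reaches (u ++ w) → Reaches (w ++ u)
  Reaches-rotate u w r = subst Reaches (ρ^-++ u w) (Reaches-ρ^ (2 * size u) r)

  -- A backward rotation composed of forward ones: u(w), (w)u, w(u), (u)w.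
  Reaches-ρ⁻ : ∀ u w → Reaches (u ++ ⟨ w ⟩ ε) → Reaches (⟨ u ⟩ w)
  Reaches-ρ⁻ u w r =
    Reaches-rotate w (⟨ u ⟩ ε) (Reaches-ρ {⟨ w ⟩ u} (Reaches-rotate u (⟨ w ⟩ ε) r))

  -- The chord around e is a diameter. Rotation decides which half is read as its inside, so the
  -- inequality of `Reaches-diameter` can be met in either case.
  Reaches-half : ∀ v e → size v ≡ H → size e ≡ H → Reaches (v ++ ⟨ e ⟩ ε)
  Reaches-half (⟨ x ⟩ y) (⟨ a ⟩ b) p q with ≤-total (size a) (size x)
  ... | inj₁ a≤x = Reaches-rotate (⟨ ⟨ a ⟩ b ⟩ ε) (⟨ x ⟩ y) (Reaches-diameter a b x y q p a≤x)
  ... | inj₂ x≤a = Reaches-ρ (Reaches-diameter x y a b p q x≤a)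

  other-half : ∀ a {b} → a + b ≡ H + H → H ≤ a → b ≤ H
  other-half a {b} eq H≤a = +-cancelˡ-≤ a b H (≤-trans (≤-reflexive eq) (+-monoˡ-≤ H H≤a))

  -- The tree ⟨ e ⟩ lies on one side of the centre and is enlarged until it spans
  -- a diameter: the chord ⟨ z ⟩ reaching the antipode either already separates
  -- ⟨ e ⟩ from the centre, or is flipped with the first chord after ⟨ e ⟩.
  Reaches-small : ∀ k v e → size v + size e ≡ H + H → size e ≤ H → H ≤ size e + k →
                  Reaches (v ++ ⟨ e ⟩ ε)
  Reaches-small k v e tot e≤H H≤ with size e ≟ H
  ... | yes e≡H = Reaches-half v e (+-cancelʳ-≡ H (size v) H (subst (λ s → size v + s ≡ H + H) e≡H tot)) e≡H
  Reaches-small zero v e tot e≤H H≤ | no e≢H =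
    ⊥-elim (e≢H (≤-antisym e≤H (subst (H ≤_) (+-identityʳ _) H≤)))
  Reaches-small (suc k) v e tot e≤H H≤ | no e≢H with split H v H<v
    where
    H<v : H < size v
    H<v = ≰⇒> λ v≤H → <⇒≢ (+-mono-≤-< v≤H (≤∧≢⇒< e≤H e≢H)) tot
  ... | v′ , z , t , refl , v′≤H , H≤v′z = step v′ v′≤H H≤v′z tot
    where
    -- The fuel bounds the number of edges that e lacks to H; every recursive call gains at least
    -- one.
    enlarged : ∀ {s} → suc (size e) ≤ s → H ≤ s + k
    enlarged e<s = ≤-trans H≤ (≤-trans (≤-reflexive (+-suc (size e) k)) (+-monoˡ-≤ k e<s))

    step : ∀ v′ → size v′ ≤ H → H ≤ size v′ + size z → size (v′ ++ ⟨ z ⟩ t) + size e ≡ H + H →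
           Reaches ((v′ ++ ⟨ z ⟩ t) ++ ⟨ e ⟩ ε)
    step v′ v′≤H H≤v′z tot with H ≤? size z
    -- Here z alone fills a half, so the other side e′ = t(e)v′ of its chord has at most H edges.
    -- Rotation makes this side the enclosed one.
    ... | yes H≤z = subst Reaches assoc
      (Reaches-rotate (t ++ ⟨ e ⟩ ε) (v′ ++ ⟨ z ⟩ ε) (subst Reaches assoc′
        (Reaches-ρ {⟨ e′ ⟩ z} (Reaches-rotate z (⟨ e′ ⟩ ε)
          (Reaches-small k z e′ tot′ (other-half (size z) tot′ H≤z)
            (enlarged (subst (suc (size e) ≤_) (sym size-e′)
              (≤-trans (s≤s (m≤m+n _ _)) (m≤n+m _ (size t))))))))))
      where
      e′ = t ++ ⟨ e ⟩ v′
      size-e′ : size e′ ≡ size t + suc (size e + size v′)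
      size-e′ = size-++ t (⟨ e ⟩ v′)
      tot′ : size z + size e′ ≡ H + H
      tot′ = trans (cong (size z +_) size-e′) (trans (lem (size z) (size t) (size e) (size v′))
               (trans (cong (_+ size e) (sym (size-++ v′ (⟨ z ⟩ t)))) tot))
        where
        lem : ∀ z t e v → z + (t + (1 + (e + v))) ≡ (v + (1 + (z + t))) + e
        lem = solve-∀
      assoc : (v′ ++ ⟨ z ⟩ ε) ++ (t ++ ⟨ e ⟩ ε) ≡ (v′ ++ ⟨ z ⟩ t) ++ ⟨ e ⟩ ε
      assoc = trans (++-assoc v′ (⟨ z ⟩ ε) (t ++ ⟨ e ⟩ ε)) (sym (++-assoc v′ (⟨ z ⟩ t) (⟨ e ⟩ ε)))
      assoc′ : e′ ++ ⟨ z ⟩ ε ≡ (t ++ ⟨ e ⟩ ε) ++ (v′ ++ ⟨ z ⟩ ε)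
      assoc′ = trans (++-assoc t (⟨ e ⟩ v′) (⟨ z ⟩ ε)) (sym (++-assoc t (⟨ e ⟩ ε) (v′ ++ ⟨ z ⟩ ε)))
    step ε v′≤H H≤v′z tot | no H≰z = ⊥-elim (H≰z H≤v′z)
    -- Flipping `(u)` with `(z)` gives (y)e′, where y = u(v″)z and e′ = t(e). Since |y| = |v′| + |z|
    -- is at least H, e′ has at most H edges: it bounds the last arc and is the enlarged side.
    step (⟨ u ⟩ v″) v′≤H H≤v′z tot | no H≰z =
      subst (λ s → Reaches (⟨ u ⟩ s)) (sym (++-assoc v″ (⟨ z ⟩ t) (⟨ e ⟩ ε)))
        (Reaches-~ (merge u v″ z e′ (≤-trans (m≤n⇒m≤1+n (m≤m+n _ _)) v′≤H)
                      (≤-trans (m≤n⇒m≤1+n (m≤n+m _ _)) v′≤H) (<⇒≤ (≰⇒> H≰z)) e′≤H total ◅ done)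
          (Reaches-ρ⁻ y e′ (Reaches-small k y e′ tot′ e′≤H
            (enlarged (subst (suc (size e) ≤_) (sym size-e′) (m≤n+m _ (size t)))))))
      where
      e′ = t ++ ⟨ e ⟩ ε
      y  = u ++ ⟨ v″ ⟩ z
      size-e′ : size e′ ≡ size t + suc (size e)
      size-e′ = trans (size-++ t (⟨ e ⟩ ε)) (cong (λ s → size t + suc s) (+-identityʳ _))
      size-y : size y ≡ suc (size u + size v″) + size z
      size-y = trans (size-++ u (⟨ v″ ⟩ z)) (lem (size u) (size v″) (size z))
        where
        lem : ∀ u v z → u + (1 + (v + z)) ≡ (1 + (u + v)) + z
        lem = solve-∀
      tot′ : size y + size e′ ≡ H + H
      tot′ = trans (cong₂ _+_ size-y size-e′)
        (trans (lem (suc (size u + size v″)) (size z) (size t) (size e))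
        (trans (cong (_+ size e) (sym (size-++ (⟨ u ⟩ v″) (⟨ z ⟩ t)))) tot))
        where
        lem : ∀ v z t e → (v + z) + (t + (1 + e)) ≡ (v + (1 + (z + t))) + e
        lem = solve-∀
      e′≤H : size e′ ≤ H
      e′≤H = other-half (size y) tot′ (subst (H ≤_) (sym size-y) H≤v′z)
      total : size (⟨ u ⟩ (v″ ++ ⟨ z ⟩ e′)) ≡ n
      total = trans (size-++ (⟨ u ⟩ v″) (⟨ z ⟩ e′)) (trans (lem (suc (size u + size v″)) (size z) (size e′))
        (cong suc (trans (cong (_+ size e′) (sym size-y)) (trans tot′ (cong (H +_) (sym (+-identityʳ H)))))))
        where
        lem : ∀ v z e → v + (1 + (z + e)) ≡ 1 + ((v + z) + e)
        lem = solve-∀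

  -- One side of the first chord has at most H edges. Growth starts from that side, after a rotation
  -- that makes it the content of the last tree.
  Reaches-all : ∀ F → size F ≡ n → Reaches F
  Reaches-all (⟨ u ⟩ w) s with size u ≤? H
  ... | yes u≤H = Reaches-rotate w (⟨ u ⟩ ε)
    (Reaches-small H w u (trans (+-comm (size w) (size u)) tot) u≤H (m≤n+m H _))
    where
    tot : size u + size w ≡ H + H
    tot = trans (suc-injective s) (cong (H +_) (+-identityʳ H))
  ... | no u≰H = Reaches-ρ⁻ u w
    (Reaches-small H u w tot (other-half (size u) tot (<⇒≤ (≰⇒> u≰H))) (m≤n+m H _))
    where
    tot : size u + size w ≡ H + H
    tot = trans (suc-injective s) (cong (H +_) (+-identityʳ H))

  connected : ∀ F G → size F ≡ n → size G ≡ n → F ~[ n ] G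
  connected F G sF sG with Reaches-all F sF | Reaches-all G sG
  ... | V , sV , p | W , sW , q = p ◅◅ lift-connected V W sV sW ◅◅ ~-sym q

-- Base case and induction

size≡0 : ∀ F → size F ≡ 0 → F ≡ ε
size≡0 ε _ = refl

size≡1 : ∀ F → size F ≡ 1 → F ≡ ⟨ ε ⟩ ε
size≡1 (⟨ u ⟩ w) s = cong₂ ⟨_⟩_
  (size≡0 u (m+n≡0⇒m≡0 (size u) (suc-injective s)))
  (size≡0 w (m+n≡0⇒n≡0 (size u) (suc-injective s)))

forests-connected : ∀ h F G → size F ≡ suc (2 * h) → size G ≡ suc (2 * h) → F ~[ suc (2 * h) ] G
forests-connected zero    F G sF sG = ~-reflexive (trans (size≡1 F sF) (sym (size≡1 G sG)))
forests-connected (suc h) F G sF sG = Step.connected h (forests-connected h) F G sF sG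

-- Forests and matchings

module _ {n : ℕ} where

  _⊨_ : NCPM n → Forest → Set
  M ⊨ F = ∀ x → E 0 F (toℕ x) (toℕ (proj₁ M x))

  infix 4 _⊨_

  point : ∀ {i} → i < 2 * n → Σ (Point n) λ x → toℕ x ≡ i
  point i<2n = fromℕ< i<2n , toℕ-fromℕ< i<2n

  realise : ∀ F → size F ≡ n → Σ (NCPM n) (_⊨ F)
  realise F s = (m , (involutive , irreflexive) , noncrossing) , matches
    where
    at : (x : Point n) → ∃ (E 0 F (toℕ x))
    at x = E-at F s (toℕ<n x)
    m : Point n → Point n
    m x = fromℕ< (E-bound s (E-sym (proj₂ (at x))))
    matches : ∀ x → E 0 F (toℕ x) (toℕ (m x))
    matches x = subst (E 0 F (toℕ x)) (sym (toℕ-fromℕ< _)) (proj₂ (at x))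
    involutive : ∀ x → m (m x) ≡ x
    involutive x = toℕ-injective (E-functional (matches (m x)) (E-sym (matches x)))
    irreflexive : ∀ x → m x ≢ x
    irreflexive x eq = E-irrefl (subst (λ y → E 0 F (toℕ x) (toℕ y)) eq (matches x))
    noncrossing : IsNonCrossing n m
    noncrossing x y _ _ (a , b , c) = E-noncrossing (matches x) (matches y) a b c

  -- Recursive descent on intervals closed under m. The chord from the first point a to its partner
  -- c leaves the points between them and the points behind c, and both intervals are closed again
  -- since no chord crosses it. The fuel k bounds the length.
  parse : (M : NCPM n) → ∃ λ F → size F ≡ n × M ⊨ F
  parse (m , (involutive , irreflexive) , noncrossing) =
    let F , end≡ , matches = go (2 * n) 0 (2 * n) (m≤m+n _ 0) z≤n ≤-refl (λ _ _ → z≤n , toℕ<n _)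
    in F , *-cancelˡ-≡ (size F) n 2 (trans (sym (+-identityʳ _)) (trans (sym (end-size 0 F)) end≡))
         , λ x → matches z≤n (toℕ<n x)
    where
    Closed : ℕ → ℕ → Set
    Closed a b = ∀ {x} → a ≤ toℕ x → toℕ x < b → a ≤ toℕ (m x) × toℕ (m x) < b

    partner-sym : ∀ {x y} → m x ≡ y → m y ≡ x
    partner-sym refl = involutive _

    go : ∀ k a b → b ≤ k + a → a ≤ b → b ≤ 2 * n → Closed a b →
         ∃ λ F → end a F ≡ b × (∀ {x} → a ≤ toℕ x → toℕ x < b → E a F (toℕ x) (toℕ (m x)))
    go zero a b b≤a a≤b _ _ =
      ε , ≤-antisym a≤b b≤a , λ a≤x x<b → ⊥-elim (<⇒≱ (<-≤-trans x<b b≤a) a≤x)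
    go (suc k) a b b≤ a≤b b≤2n closed with a ≟ b
    ... | yes refl = ε , refl , λ a≤x x<b → ⊥-elim (<⇒≱ x<b a≤x)
    ... | no a≢b with point (<-≤-trans (≤∧≢⇒< a≤b a≢b) b≤2n)
    ...   | s , refl =
      ⟨ u ⟩ w , trans (cong (λ c → end (suc c) w) end-u) end-w , matches
      where
      c = toℕ (m s)
      a<b : a < b
      a<b = ≤∧≢⇒< a≤b a≢b
      a<c : a < c
      a<c = ≤∧≢⇒< (proj₁ (closed ≤-refl a<b)) λ eq → irreflexive s (sym (toℕ-injective eq))
      c<b : c < b
      c<b = proj₂ (closed ≤-refl a<b)
      ≢s : ∀ {x} → toℕ x ≢ c → a ≢ toℕ (m x)
      ≢s x≢c eq = x≢c (cong toℕ (sym (partner-sym (sym (toℕ-injective eq)))))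
      ≢ms : ∀ {x} → a ≢ toℕ x → toℕ (m x) ≢ c
      ≢ms {x} a≢x eq = a≢x (cong toℕ (trans (sym (involutive s)) (partner-sym (toℕ-injective eq))))
      closed-u : Closed (suc a) c
      closed-u {x} a<x x<c =
        ≤∧≢⇒< (proj₁ (closed (<⇒≤ a<x) (<-trans x<c c<b))) (≢s (<⇒≢ x<c)) ,
        ≰⇒> λ c≤mx → let c<mx = ≤∧≢⇒< c≤mx λ eq → ≢ms (<⇒≢ a<x) (sym eq) in
          noncrossing s x a<c (<-trans x<c c<mx) (a<x , x<c , c<mx)
      closed-w : Closed (suc c) b
      closed-w {x} c<x x<b =
        (≰⇒> λ mx≤c →
          let mx<c = ≤∧≢⇒< mx≤c (≢ms (<⇒≢ (<-trans a<c c<x)))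
              a<mx = ≤∧≢⇒< (proj₁ (closed (<⇒≤ (<-trans a<c c<x)) x<b)) (≢s λ eq → <⇒≢ c<x (sym eq))
              c<mmx = subst (λ y → c < toℕ y) (sym (involutive x)) c<x
          -- The offending chord of x has its smaller end at `m x`, so the crossing is expressed
          -- there.
          in noncrossing s (m x) a<c (<-trans mx<c c<mmx) (a<mx , mx<c , c<mmx)) ,
        proj₂ (closed (<⇒≤ (<-trans a<c c<x)) x<b)
      inner = go k (suc a) c (≤-trans (<⇒≤ c<b) (subst (b ≤_) (sym (+-suc k a)) b≤))
                a<c (≤-trans (<⇒≤ c<b) b≤2n) closed-u
      outer = go k (suc c) b (≤-trans b≤ (subst (_≤ k + suc c) (+-suc k a)
                (+-monoʳ-≤ k (s≤s (<⇒≤ a<c))))) c<b b≤2n closed-w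
      u = proj₁ inner
      w = proj₁ outer
      end-u : end (suc a) u ≡ c
      end-u = proj₁ (proj₂ inner)
      end-w : end (suc c) w ≡ b
      end-w = proj₁ (proj₂ outer)
      matches : ∀ {x} → a ≤ toℕ x → toℕ x < b → E a (⟨ u ⟩ w) (toℕ x) (toℕ (m x))
      matches {x} a≤x x<b with a ≟ toℕ x
      ... | yes eq = opens (sym eq) (trans (cong (λ y → toℕ (m y)) (sym (toℕ-injective eq))) (sym end-u))
      ... | no a≢x with <-cmp (toℕ x) c
      ...   | tri< x<c _ _ = inside (proj₂ (proj₂ inner) (≤∧≢⇒< a≤x a≢x) x<c)
      ...   | tri≈ _ x≡c _ = closes (trans x≡c (sym end-u))
                (cong toℕ (partner-sym (sym (toℕ-injective x≡c))))
      ...   | tri> _ _ c<x = after (E-cast (cong suc (sym end-u)) (proj₂ (proj₂ outer) c<x x<b))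

  flip-sound : ∀ {F G} {M M′ : NCPM n} → M ⊨ F → M′ ⊨ G → Flip n F G → CenteredFlip n M M′
  flip-sound {F} {G} {M@(m , _)} {M′@(m′ , _)} M⊨F M′⊨G
             (mkFlip sF sG {p₁} {p₂} {p₃} {p₄} <₁ <₂ <₃ pairs empty agree a₁ a₂ a₃ a₄)
    with point₄ | point₁ | point₂ | point₃
    where
    p₄< : p₄ < 2 * n
    p₄< = E-bound sF (proj₂ (last-matched pairs))
    point₄ = point p₄<
    point₃ = point (<-trans <₃ p₄<)
    point₂ = point (<-trans <₂ (<-trans <₃ p₄<))
    point₁ = point (<-trans <₁ (<-trans <₂ (<-trans <₃ p₄<)))
  ... | P₄ , refl | P₁ , refl | P₂ , refl | P₃ , refl =
    P₁ , P₂ , P₃ , P₄ ,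
    (<₁ , <₂ , <₃ , hasEdges pairs , (λ x av → empty (M⊨F x) (off av)) ,
      λ x av → toℕ-injective (E-functional (M′⊨G x) (agree (M⊨F x) (off av)))) ,
    short a₁ , short a₂ , short a₃ ,
    m≤n+o⇒m∸n≤o (2 * n + toℕ P₁) (toℕ P₄)
      (≤-trans (≤-reflexive (lem n (toℕ P₁))) (+-monoˡ-≤ n a₄))
    where
    lem : ∀ n p → 2 * n + p ≡ (n + p) + n
    lem = solve-∀
    short : ∀ {p q} → q ≤ n + p → q ∸ p ≤ n
    short {p} {q} q≤ = m≤n+o⇒m∸n≤o q p (subst (q ≤_) (+-comm n p) q≤)
    off : ∀ {x} → Avoids n P₁ P₂ P₃ P₄ x → Off (toℕ P₁) (toℕ P₂) (toℕ P₃) (toℕ P₄) (toℕ x)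
    off (a , b , c , d) = (λ e → a (toℕ-injective e)) , (λ e → b (toℕ-injective e)) ,
                          (λ e → c (toℕ-injective e)) , (λ e → d (toℕ-injective e))
    edgesOf : ∀ {N : NCPM n} {K} → N ⊨ K → ∀ {a b c d} →
              Pairs K (toℕ a) (toℕ b) (toℕ c) (toℕ d) → HasEdges n (proj₁ N) a b c d
    edgesOf N⊨K (e , f) =
      toℕ-injective (E-functional (N⊨K _) e) , toℕ-injective (E-functional (N⊨K _) (E-sym e)) ,
      toℕ-injective (E-functional (N⊨K _) f) , toℕ-injective (E-functional (N⊨K _) (E-sym f))
    hasEdges : _ → _
    hasEdges (inj₁ (p , q)) = inj₁ (edgesOf {M} M⊨F p , edgesOf {M′} M′⊨G q)
    hasEdges (inj₂ (p , q)) = inj₂ (edgesOf {M} M⊨F p , edgesOf {M′} M′⊨G q)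

  -- Only intermediate words are realised; the given M and M′ remain the ends themselves, which
  -- requires at least one flip.
  path-sound : ∀ {F G K} {M M′ : NCPM n} → M ⊨ F → M′ ⊨ K → Flip n F G → G ~[ n ] K →
               Star (CenteredFlip n) M M′
  path-sound {M = M} {M′} M⊨F M′⊨K f done = flip-sound {M = M} {M′} M⊨F M′⊨K f ◅ done
  path-sound {G = G} {M = M} {M′} M⊨F M′⊨K f (g ◅ gs) =
    let N , N⊨G = realise G (Flip.sizeʳ f)
    in flip-sound {M = M} {N} M⊨F N⊨G f ◅ path-sound {M = N} {M′} N⊨G M′⊨K g gs

-- Without function extensionality the trivial path only joins a matching to
-- itself, not to a pointwise equal one, so all paths go through a different forest.
other : ∀ k F → size F ≡ 2 + k → ∃ λ G → size G ≡ 2 + k × F ≢ G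
other k (⟨ ε ⟩ w)       _ = ⟨ ⟨ ε ⟩ ε ⟩ replicate k , cong (2 +_) (size-replicate k) , λ ()
other k (⟨ ⟨ u ⟩ v ⟩ w) _ = replicate (2 + k) , size-replicate (2 + k) , λ ()

theorem6 : (n : ℕ) → 3 ≤ n → Odd n → Connected𝓗 n
theorem6 n (s≤s (s≤s _)) (h , n≡) M M′ with parse M | parse M′
... | F , sF , M⊨F | F′ , sF′ , M′⊨F′ with other _ F sF
...   | G , sG , F≢G = via (connected F G sF sG) (connected G F′ sG sF′)
  where
  connected : ∀ F G → size F ≡ n → size G ≡ n → F ~[ n ] G
  connected = subst (λ n → ∀ F G → size F ≡ n → size G ≡ n → F ~[ n ] G) (sym n≡) (forests-connected h)
  via : F ~[ n ] G → G ~[ n ] F′ → Star (CenteredFlip n) M M′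
  via done     _  = ⊥-elim (F≢G refl)
  via (f ◅ fs) gs = path-sound {M = M} {M′} M⊨F M′⊨F′ f (fs ◅◅ gs)
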